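{- Let $n$, $k\le n$, and $D$ be nonnegative integers, let $t$ be a positive integer, and let $M$ be a mask on ground set $[n]$ such that the maximum $M$-degree of any vertex in $V(M)$ is at most $2t$. Then there exists a mask $M'$ on ground set $[n]$ such that: 1. $\mathsf{LDUB}(n,M)\le\mathsf{LDUB}(n,M')$; 2. $|V(M')|\le 2t+2+\frac{2|M|}{t}$.
   Context: $[n]=\{1,\dots,n\}$. A mask $M$ on ground set $[n]$ is a subset of $\binom{[n]}{2}$ (unordered pairs of distinct elements), viewed as the edge set of a graph with vertex set $V(M)=\{v\in[n]:\exists u\in[n],\ (u,v)\in M\}$; $|M|$ is the number of edges. For $v\in V(M)$ its $M$-degree is $\deg^M(v)=|\{u\in V(M):(u,v)\in M\}|$. Low-degree likelihood ratio upper bound: given integers $n$, $k\le n$, $D$ and a mask $M$ on $[n]$, let $X,X'$ be independent random vectors, each uniform over the vectors in $\{0,1\}^{[n]}$ with exactly $k$ nonzero coordinates, and let $Z_i=X_iX'_i$ for $i\in[n]$. Define $$\mathsf{LDUB}(n,M)=1+\sum_{d=1}^{D}\frac{1}{d!}\,\mathbb{E}\Bigl[\Bigl(\sum_{(i,j)\in M}Z_iZ_j\Bigr)^d\Bigr],$$ where the inner sum counts each unordered pair in $M$ once. The dependence on $k$ and $D$ is suppressed in the notation; the same $k$ and $D$ are used on both sides of the inequality. -}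

module Defs where

open import Data.Bool using (Bool; true; false; T; if_then_else_)
open import Data.Bool.Properties using (T?)
open import Data.Fin using (Fin)
import Data.Fin as Fin
open import Data.Fin.Properties using (any?)
open import Data.Fin.Subset using (Subset; inside; outside; ∣_∣; _∩_)
open import Data.Integer using (+_)
open import Data.List using (List; []; _∷_; _++_; map; filter; foldr; length; allFin; upTo; cartesianProduct)
open import Data.Nat using (ℕ; zero; suc; _*_; _^_; _!; _≟_)
open import Data.Nat.ListAction using (sum)
open import Data.Nat.Properties using (_!≢0)
open import Data.Product using (_×_; _,_; proj₁; proj₂)
open import Data.Rational using (ℚ; 0ℚ; 1ℚ; _/_)
import Data.Rational as ℚ
open import Data.Vec using ([]; _∷_; lookup; tabulate)
open import Relation.Binary.PropositionalEquality using (_≡_)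
open import Relation.Nullary.Decidable using (does; _×-dec_)

-- A set of unordered pairs of distinct elements of Fin n, given by its
-- (symmetric, irreflexive) membership relation.
record Mask (n : ℕ) : Set where
  field
    adj        : Fin n → Fin n → Bool
    adj-sym    : ∀ u v → adj u v ≡ adj v u
    adj-irrefl : ∀ v → adj v v ≡ false

open Mask public

-- Each unordered pair {i , j} of the mask is listed exactly once, as (i , j) with i < j.
edges : ∀ {n} → Mask n → List (Fin n × Fin n)
edges {n} M =
  filter (λ e → (proj₁ e Fin.<? proj₂ e) ×-dec T? (adj M (proj₁ e) (proj₂ e)))
         (cartesianProduct (allFin n) (allFin n))

size : ∀ {n} → Mask n → ℕ
size M = length (edges M)

V : ∀ {n} → Mask n → Subset n
V M = tabulate λ v → does (any? λ u → T? (adj M u v))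

deg : ∀ {n} → Mask n → Fin n → ℕ
deg M v = ∣ V M ∩ tabulate (λ u → adj M u v) ∣

-- Vectors in {0,1}^n are elements of Subset n, i.e. Vec Bool n; every one is
-- listed exactly once.
cube : ∀ n → List (Subset n)
cube zero    = [] ∷ []
cube (suc n) = map (outside ∷_) (cube n) ++ map (inside ∷_) (cube n)

layer : ∀ n → ℕ → List (Subset n)
layer n k = filter (λ x → ∣ x ∣ ≟ k) (cube n)

sumℚ : List ℚ → ℚ
sumℚ = foldr ℚ._+_ 0ℚ

-- Expectation under the uniform distribution on the entries of a list.  The value
-- 0 on the empty list is a convention; layer n k is nonempty whenever k ≤ n.
𝔼 : ∀ {A : Set} → List A → (A → ℚ) → ℚ
𝔼 []          f = 0ℚ
𝔼 Ω@(_ ∷ ω) f = sumℚ (map f Ω) ℚ.* (+ 1 / suc (length ω))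

coord : ∀ {n} → Subset n → Fin n → ℕ
coord x i = if lookup x i then 1 else 0

Z : ∀ {n} → Subset n × Subset n → Fin n → ℕ
Z (x , x′) i = coord x i * coord x′ i

pairSum : ∀ {n} → Mask n → Subset n × Subset n → ℕ
pairSum M ω = sum (map (λ e → Z ω (proj₁ e) * Z ω (proj₂ e)) (edges M))

-- The pair (X , X′) of independent uniform vectors is uniform on the product.
moment : ∀ {n} → (k : ℕ) → Mask n → (d : ℕ) → ℚ
moment {n} k M d =
  𝔼 (cartesianProduct (layer n k) (layer n k)) (λ ω → + (pairSum M ω ^ d) / 1)

LDUB : (k D n : ℕ) → Mask n → ℚ
LDUB k D n M = 1ℚ ℚ.+ sumℚ (map (λ d → term (suc d)) (upTo D))
  where
  term : ℕ → ℚ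
  term d = (_/_ (+ 1) (d !) {{d !≢0}}) ℚ.* moment k M d

{-# OPTIONS --safe #-}
module Submission where

-- For two vertices u, v, the compression moves to u every edge vw with w not adjacent to u.
-- If p, q are the values of the quadratic form ∑ Z_i Z_j of M before and after exchanging the
-- exchangeable pairs (X_u, X′_u) and (X_v, X′_v), and p′, q′ those of the compression, then
-- p + q = p′ + q′ and max(p′, q′) ≥ max(p, q), so convexity of x ↦ x^d shows that no moment
-- decreases. The number of edges is preserved. Compress repeatedly from v into u whenever v < u
-- and both have degree < t; degrees stay at most 2t, and ∑ (n − i) deg i strictly drops, so this
-- stops. In the final mask the neighbourhoods of the non-isolated vertices of degree < t are
-- nested, so all these vertices lie in the closed neighbourhood of a single vertex, which has
-- at most 2t + 1 elements; by the handshake lemma at most 2|M|/t vertices have degree ≥ t.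

open import Defs
open import Data.Fin using (Fin)
open import Data.Fin.Subset using (_∈_; ∣_∣)
open import Data.Integer using (+_)
open import Data.Nat using (ℕ; NonZero; _+_; _*_; _≤_)
open import Data.Product using (Σ; _×_)
open import Data.Rational using (_/_) renaming (_≤_ to _≤ℚ_; _+_ to _+ℚ_)

open import Data.Bool using (Bool; true; false; T; _∧_; _∨_; not; if_then_else_)
open import Data.Bool.Properties using (T?)
open import Data.Fin using (toℕ; fromℕ<) renaming (zero to 0F; suc to sucF; _<?_ to _<?F_; _<_ to _<F_; _≟_ to _≟F_)
open import Data.Fin.Permutation using (Permutation; permutation)
open import Data.Fin.Properties using (any?; all?; ¬∀⟶∃¬-smallest; toℕ≤n; toℕ-inject; toℕ-fromℕ<; toℕ-injective; <-cmp)
open import Data.Fin.Subset using (Subset; inside; outside; _∩_)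
import Data.Integer as ℤ
import Data.Integer.Properties as ℤ
open import Data.List using (List; []; _∷_; _++_; map; filter; length; allFin; upTo; cartesianProduct)
open import Data.List.Membership.Propositional using () renaming (_∈_ to _∈ˡ_)
open import Data.List.Membership.Propositional.Properties
  using (∈-map⁺; ∈-map⁻; ∈-++⁺ˡ; ∈-++⁺ʳ; ∈-filter⁺; ∈-filter⁻)
open import Data.List.Properties using (map-++; map-∘; map-cong)
open import Data.List.Relation.Binary.Permutation.Propositional using (_↭_)
open import Data.List.Relation.Binary.Permutation.Propositional.Properties using (map⁺)
open import Data.List.Membership.Propositional.Properties.WithK using (unique∧set⇒bag)
open import Data.List.Relation.Binary.BagAndSetEquality using (∼bag⇒↭)
open import Data.List.Relation.Unary.Any using (here)
open import Data.List.Relation.Unary.Unique.Propositional using (Unique)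
import Data.List.Relation.Unary.Unique.Propositional.Properties as Unique
import Data.List.Relation.Unary.AllPairs as AllPairs
import Data.List.Relation.Unary.All as All
open import Data.Nat using (zero; suc; _^_; _!; _<_; _∸_; _≟_; _<?_; _≤?_; z≤n; s≤s)
open import Data.Nat.Induction using (<-wellFounded)
open import Data.Nat.ListAction using () renaming (sum to sumˡ)
open import Data.Nat.ListAction.Properties using (sum-++; sum-↭)
open import Data.Nat.Properties hiding (_≟_; _<?_; _≤?_; <-cmp)
open import Data.Nat.Tactic.RingSolver using (solve-∀)
open import Data.Product using (∃; _,_; proj₁; proj₂)
import Data.Rational as ℚ
import Data.Rational.Properties as ℚ
import Data.Rational.Unnormalised as ℚᵘ
import Data.Rational.Unnormalised.Properties as ℚᵘ
open import Data.Sum using (_⊎_; inj₁; inj₂)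
open import Data.Unit using (tt)
open import Data.Vec using (_∷_; []; lookup; tabulate)
open import Data.Vec.Properties
  using (lookup∘tabulate; tabulate∘lookup; tabulate-cong; lookup-zipWith; ∷-injectiveʳ; lookup⇒[]=)
open import Function using (_∘_; case_of_; mk⇔)
open import Induction.WellFounded using (Acc; acc)
open import Relation.Binary.Definitions using (tri<; tri≈; tri>)
open import Relation.Binary.PropositionalEquality
open import Relation.Nullary using (¬_; Dec; yes; no; does; contradiction)
open import Relation.Nullary.Decidable using (_×-dec_; ¬?; dec-true; dec-false; decidable-stable)
open import Algebra.Properties.Semiring.Sum +-*-semiring
  using (sum; sum-syntax; sum-cong-≗; ∑-distrib-+; ∑-comm; sum-permute; sum-replicate-zero;
         *-distribˡ-sum; *-distribʳ-sum)

-- Sums over finite index sets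

χ : Bool → ℕ
χ b = if b then 1 else 0

∑-mono-≤ : ∀ {n} {f g : Fin n → ℕ} → (∀ i → f i ≤ g i) → sum f ≤ sum g
∑-mono-≤ {zero}  f≤g = z≤n
∑-mono-≤ {suc n} f≤g = +-mono-≤ (f≤g 0F) (∑-mono-≤ (f≤g ∘ sucF))

∑-mono-< : ∀ {n} {f g : Fin n → ℕ} → (∀ i → f i ≤ g i) → ∀ i → f i < g i → sum f < sum g
∑-mono-< f≤g 0F       fi<gi = +-mono-<-≤ fi<gi (∑-mono-≤ (f≤g ∘ sucF))
∑-mono-< f≤g (sucF i) fi<gi = +-mono-≤-< (f≤g 0F) (∑-mono-< (f≤g ∘ sucF) i fi<gi)

∑-zero : ∀ {n} {f : Fin n → ℕ} → (∀ i → f i ≡ 0) → sum f ≡ 0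
∑-zero {n} f≡0 = trans (sum-cong-≗ f≡0) (sum-replicate-zero n)

∑-single : ∀ {n} (i : Fin n) {f : Fin n → ℕ} → (∀ j → j ≢ i → f j ≡ 0) → sum f ≡ f i
∑-single 0F    {f} off =
  trans (cong₂ _+_ refl (∑-zero (λ j → off (sucF j) λ ()))) (+-identityʳ _)
∑-single (sucF i) {f} off =
  cong₂ _+_ (off 0F λ ()) (∑-single i λ j j≢i → off (sucF j) λ { refl → j≢i refl })

∣∣≡∑χ : ∀ {n} (x : Subset n) → ∣ x ∣ ≡ ∑[ i < n ] χ (lookup x i)
∣∣≡∑χ []            = refl
∣∣≡∑χ (inside ∷ x)  = cong suc (∣∣≡∑χ x)
∣∣≡∑χ (outside ∷ x) = ∣∣≡∑χ x

sum-map-tabulate : ∀ {n} {A : Set} (f : A → ℕ) (g : Fin n → A) →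
  sumˡ (map f (Data.List.tabulate g)) ≡ ∑[ i < n ] f (g i)
sum-map-tabulate {zero}  f g = refl
sum-map-tabulate {suc n} f g = cong₂ _+_ refl (sum-map-tabulate f (g ∘ sucF))

sum-map-filter : ∀ {A : Set} {P : A → Set} (P? : ∀ x → Dec (P x)) (f : A → ℕ) xs →
  sumˡ (map f (filter P? xs)) ≡ sumˡ (map (λ x → χ (does (P? x)) * f x) xs)
sum-map-filter P? f []       = refl
sum-map-filter P? f (x ∷ xs) with does (P? x)
... | true  = cong₂ _+_ (sym (+-identityʳ (f x))) (sum-map-filter P? f xs)
... | false = sum-map-filter P? f xs

sum-map-cartesianProduct : ∀ {A B : Set} (f : A × B → ℕ) xs ys →
  sumˡ (map f (cartesianProduct xs ys)) ≡ sumˡ (map (λ x → sumˡ (map (λ y → f (x , y)) ys)) xs)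
sum-map-cartesianProduct f []       ys = refl
sum-map-cartesianProduct f (x ∷ xs) ys = begin
  sumˡ (map f (map (x ,_) ys ++ cartesianProduct xs ys))
    ≡⟨ cong sumˡ (map-++ f (map (x ,_) ys) _) ⟩
  sumˡ (map f (map (x ,_) ys) ++ map f (cartesianProduct xs ys))
    ≡⟨ sum-++ (map f (map (x ,_) ys)) _ ⟩
  sumˡ (map f (map (x ,_) ys)) + sumˡ (map f (cartesianProduct xs ys))
    ≡⟨ cong₂ _+_ (cong sumˡ (sym (map-∘ ys))) (sum-map-cartesianProduct f xs ys) ⟩
  sumˡ (map (λ y → f (x , y)) ys) + sumˡ (map (λ x → sumˡ (map (λ y → f (x , y)) ys)) xs) ∎
  where open ≡-Reasoning

sum-map-+ : ∀ {A : Set} (f g : A → ℕ) xs →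
  sumˡ (map (λ x → f x + g x) xs) ≡ sumˡ (map f xs) + sumˡ (map g xs)
sum-map-+ f g []       = refl
sum-map-+ f g (x ∷ xs) = trans (cong₂ _+_ refl (sum-map-+ f g xs)) (interchange (f x) (g x) _ _)
  where
  interchange : ∀ a b c d → a + b + (c + d) ≡ a + c + (b + d)
  interchange = solve-∀

sum-map-mono-≤ : ∀ {A : Set} {f g : A → ℕ} → (∀ x → f x ≤ g x) → ∀ xs → sumˡ (map f xs) ≤ sumˡ (map g xs)
sum-map-mono-≤ f≤g []       = z≤n
sum-map-mono-≤ f≤g (x ∷ xs) = +-mono-≤ (f≤g x) (sum-map-mono-≤ f≤g xs)

length≡sum-ones : ∀ {A : Set} (xs : List A) → length xs ≡ sumˡ (map (λ _ → 1) xs)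
length≡sum-ones []       = refl
length≡sum-ones (x ∷ xs) = cong suc (length≡sum-ones xs)

-- Weighted edge counts

-- The sum runs over ordered pairs, so every edge of a mask counts twice. This form is symmetric, so
-- relabelling and compression need not track which endpoint is smaller.
∑∑ : ∀ {n} → (Fin n → Fin n → Bool) → (Fin n → Fin n → ℕ) → ℕ
∑∑ {n} a f = ∑[ i < n ] ∑[ j < n ] (χ (a i j) * f i j)

-- Unlike `deg`, this counts neighbours among all of `Fin n`, which turns degree arguments into
-- plain sums; `deg≤⇒degree≤` carries the hypothesis over.
degree : ∀ {n} → (Fin n → Fin n → Bool) → Fin n → ℕ
degree {n} a i = ∑[ j < n ] χ (a i j)

-- Here `δ` is the indicator of `x`, and `δ i * e j + δ j * e i` is the matrix of a star centred at
-- `x` with leaf weights `e`. Only the row and the column of `x` survive.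
∑∑-attach : ∀ {n} {δ : Fin n → ℕ} {x} → δ x ≡ 1 → (∀ i → i ≢ x → δ i ≡ 0) →
  ∀ (e : Fin n → ℕ) (f : Fin n → Fin n → ℕ) →
  (∑[ i < n ] ∑[ j < n ] ((δ i * e j + δ j * e i) * f i j)) ≡ ∑[ w < n ] (e w * (f x w + f w x))
∑∑-attach {n} {δ} {x} on off e f = begin
  (∑[ i < n ] ∑[ j < n ] ((δ i * e j + δ j * e i) * f i j))
    ≡⟨ sum-cong-≗ (λ i → trans (sum-cong-≗ (λ j → regroup (δ i) (δ j) (e i) (e j) (f i j)))
         (∑-distrib-+ (λ j → δ i * (e j * f i j)) _)) ⟩
  (∑[ i < n ] ((∑[ j < n ] (δ i * (e j * f i j))) + (∑[ j < n ] (δ j * (e i * f i j)))))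
    ≡⟨ ∑-distrib-+ (λ i → ∑[ j < n ] (δ i * (e j * f i j))) _ ⟩
  (∑[ i < n ] ∑[ j < n ] (δ i * (e j * f i j))) + (∑[ i < n ] ∑[ j < n ] (δ j * (e i * f i j)))
    ≡⟨ cong₂ _+_
         (trans (∑-single x λ i i≢x → ∑-zero λ j → cong (_* (e j * f i j)) (off i i≢x))
                (sum-cong-≗ λ j → scale (e j * f x j)))
         (sum-cong-≗ λ i → trans (∑-single x λ j j≢x → cong (_* (e i * f i j)) (off j j≢x))
                                 (scale (e i * f i x))) ⟩
  (∑[ w < n ] (e w * f x w)) + (∑[ w < n ] (e w * f w x))
    ≡⟨ ∑-distrib-+ (λ w → e w * f x w) _ ⟨
  (∑[ w < n ] (e w * f x w + e w * f w x))
    ≡⟨ sum-cong-≗ (λ w → sym (*-distribˡ-+ (e w) (f x w) (f w x))) ⟩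
  (∑[ w < n ] (e w * (f x w + f w x))) ∎
  where
  open ≡-Reasoning
  regroup : ∀ di dj ei ej g → (di * ej + dj * ei) * g ≡ di * (ej * g) + dj * (ei * g)
  regroup = solve-∀
  scale : ∀ c → δ x * c ≡ c
  scale c = trans (cong (_* c) on) (*-identityˡ c)

∑∑-+ : ∀ {n} (b : Fin n → Fin n → Bool) (d f : Fin n → Fin n → ℕ) →
  ∑∑ b f + (∑[ i < n ] ∑[ j < n ] (d i j * f i j)) ≡ ∑[ i < n ] ∑[ j < n ] ((χ (b i j) + d i j) * f i j)
∑∑-+ b d f = sym (trans
  (sum-cong-≗ λ i → trans
    (sum-cong-≗ λ j → *-distribʳ-+ (f i j) (χ (b i j)) (d i j))
    (∑-distrib-+ (λ j → χ (b i j) * f i j) _))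
  (∑-distrib-+ (λ i → sum (λ j → χ (b i j) * f i j)) _))

module _ {n : ℕ} (M : Mask n) where

  private
    a = adj M

    ordered : Fin n → Fin n → Bool
    ordered i j = does (i <?F j) ∧ a i j

  sum-edges : (f : Fin n × Fin n → ℕ) →
    sumˡ (map f (edges M)) ≡ ∑[ i < n ] ∑[ j < n ] (χ (ordered i j) * f (i , j))
  sum-edges f = begin
    sumˡ (map f (edges M))
      ≡⟨ sum-map-filter edge? f (cartesianProduct (allFin n) (allFin n)) ⟩
    sumˡ (map g (cartesianProduct (allFin n) (allFin n)))
      ≡⟨ sum-map-cartesianProduct g (allFin n) (allFin n) ⟩
    sumˡ (map (λ i → sumˡ (map (λ j → g (i , j)) (allFin n))) (allFin n))
      ≡⟨ sum-map-tabulate (λ i → sumˡ (map (λ j → g (i , j)) (allFin n))) (λ i → i) ⟩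
    (∑[ i < n ] sumˡ (map (λ j → g (i , j)) (allFin n)))
      ≡⟨ sum-cong-≗ (λ i → sum-map-tabulate (λ j → g (i , j)) (λ j → j)) ⟩
    (∑[ i < n ] ∑[ j < n ] (χ (ordered i j) * f (i , j))) ∎
    where
    open ≡-Reasoning
    edge? = λ (e : Fin n × Fin n) → (proj₁ e <?F proj₂ e) ×-dec T? (a (proj₁ e) (proj₂ e))
    g = λ e → χ (does (edge? e)) * f e

  -- The sum over pairs with `i < j` plus its transpose covers every off-diagonal pair once, and the
  -- diagonal vanishes by irreflexivity.
  handshake : (f : Fin n × Fin n → ℕ) → (∀ i j → f (i , j) ≡ f (j , i)) →
    2 * sumˡ (map f (edges M)) ≡ ∑∑ a (λ i j → f (i , j))
  handshake f f-sym = begin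
    2 * sumˡ (map f (edges M))
      ≡⟨ cong (2 *_) (sum-edges f) ⟩
    2 * S
      ≡⟨ cong₂ _+_ refl (+-identityʳ S) ⟩
    S + S
      ≡⟨ cong₂ _+_ refl (∑-comm (λ i j → χ (ordered i j) * f (i , j))) ⟩
    S + (∑[ i < n ] ∑[ j < n ] (χ (ordered j i) * f (j , i)))
      ≡⟨ ∑-distrib-+ (λ i → ∑[ j < n ] (χ (ordered i j) * f (i , j))) _ ⟨
    (∑[ i < n ] ((∑[ j < n ] (χ (ordered i j) * f (i , j))) + (∑[ j < n ] (χ (ordered j i) * f (j , i)))))
      ≡⟨ sum-cong-≗ (λ i → sym (∑-distrib-+ (λ j → χ (ordered i j) * f (i , j)) _)) ⟩
    (∑[ i < n ] ∑[ j < n ] (χ (ordered i j) * f (i , j) + χ (ordered j i) * f (j , i)))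
      ≡⟨ sum-cong-≗ (λ i → sum-cong-≗ (λ j → split i j)) ⟩
    ∑∑ a (λ i j → f (i , j)) ∎
    where
    open ≡-Reasoning
    S = ∑[ i < n ] ∑[ j < n ] (χ (ordered i j) * f (i , j))
    split : ∀ i j → χ (ordered i j) * f (i , j) + χ (ordered j i) * f (j , i) ≡ χ (a i j) * f (i , j)
    split i j with <-cmp i j
    ... | tri< i<j _ j≮i rewrite dec-true (i <?F j) i<j | dec-false (j <?F i) j≮i = +-identityʳ _
    ... | tri≈ i≮i refl _ rewrite dec-false (i <?F i) i≮i | adj-irrefl M i = refl
    ... | tri> i≮j _ j<i rewrite dec-false (i <?F j) i≮j | dec-true (j <?F i) j<i
          | adj-sym M j i | f-sym j i = refl

  2size : 2 * size M ≡ ∑∑ a (λ _ _ → 1)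
  2size = trans (cong (2 *_) (length≡sum-ones (edges M))) (handshake (λ _ → 1) (λ _ _ → refl))

  ∑degree : (∑[ i < n ] degree a i) ≡ 2 * size M
  ∑degree = trans (sum-cong-≗ λ i → sum-cong-≗ λ j → sym (*-identityʳ (χ (a i j)))) (sym 2size)

  2pairSum : ∀ ω → 2 * pairSum M ω ≡ ∑∑ a (λ i j → Z ω i * Z ω j)
  2pairSum ω = handshake (λ e → Z ω (proj₁ e) * Z ω (proj₂ e)) (λ i j → *-comm (Z ω i) (Z ω j))


-- Relabelling the coordinates

cube-complete : ∀ {n} (x : Subset n) → x ∈ˡ cube n
cube-complete []            = here refl
cube-complete (outside ∷ x) = ∈-++⁺ˡ (∈-map⁺ (outside ∷_) (cube-complete x))
cube-complete (inside ∷ x)  = ∈-++⁺ʳ (map (outside ∷_) (cube _)) (∈-map⁺ (inside ∷_) (cube-complete x))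

cube-unique : ∀ n → Unique (cube n)
cube-unique zero    = All.[] AllPairs.∷ AllPairs.[]
cube-unique (suc n) = Unique.++⁺
  (Unique.map⁺ ∷-injectiveʳ (cube-unique n))
  (Unique.map⁺ ∷-injectiveʳ (cube-unique n))
  λ (p , q) → case ∈-map⁻ (outside ∷_) p , ∈-map⁻ (inside ∷_) q of λ { ((_ , _ , refl) , (_ , _ , ())) }

module Relabel {n : ℕ} (σ : Fin n → Fin n) (σ-involutive : ∀ i → σ (σ i) ≡ i) where

  relabel : Subset n → Subset n
  relabel x = tabulate (lookup x ∘ σ)

  relabel-involutive : ∀ x → relabel (relabel x) ≡ x
  relabel-involutive x = trans
    (tabulate-cong λ i → trans (lookup∘tabulate (lookup x ∘ σ) (σ i)) (cong (lookup x) (σ-involutive i)))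
    (tabulate∘lookup x)

  relabel-injective : ∀ {x y} → relabel x ≡ relabel y → x ≡ y
  relabel-injective {x} {y} eq =
    trans (sym (relabel-involutive x)) (trans (cong relabel eq) (relabel-involutive y))

  ∣relabel∣ : ∀ x → ∣ relabel x ∣ ≡ ∣ x ∣
  ∣relabel∣ x = begin
    ∣ relabel x ∣                    ≡⟨ ∣∣≡∑χ (relabel x) ⟩
    (∑[ i < n ] χ (lookup (relabel x) i)) ≡⟨ sum-cong-≗ (λ i → cong χ (lookup∘tabulate (lookup x ∘ σ) i)) ⟩
    (∑[ i < n ] χ (lookup x (σ i)))  ≡⟨ sum-permute (χ ∘ lookup x) (permutation σ σ σ-involutive σ-involutive) ⟨
    (∑[ i < n ] χ (lookup x i))      ≡⟨ ∣∣≡∑χ x ⟨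
    ∣ x ∣                            ∎
    where open ≡-Reasoning

  relabel-∈-layer : ∀ {k x} → x ∈ˡ layer n k → relabel x ∈ˡ layer n k
  relabel-∈-layer {k} {x} x∈ = ∈-filter⁺ (λ x → ∣ x ∣ ≟ k) (cube-complete (relabel x))
    (trans (∣relabel∣ x) (proj₂ (∈-filter⁻ (λ x → ∣ x ∣ ≟ k) {xs = cube n} x∈)))

  -- Both lists are free of duplicates and, as `relabel` is an involution preserving cardinality,
  -- have the same elements.
  map-relabel-layer : ∀ k → map relabel (layer n k) ↭ layer n k
  map-relabel-layer k = ∼bag⇒↭ (unique∧set⇒bag
    (Unique.map⁺ relabel-injective layer-unique) layer-unique
    (mk⇔ (λ p → case ∈-map⁻ relabel p of λ { (_ , x∈ , refl) → relabel-∈-layer x∈ })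
         (λ x∈ → subst (_∈ˡ map relabel (layer n k)) (relabel-involutive _)
            (∈-map⁺ relabel (relabel-∈-layer x∈)))))
    where
    layer-unique = Unique.filter⁺ (λ x → ∣ x ∣ ≟ k) (cube-unique n)

  relabel² : Subset n × Subset n → Subset n × Subset n
  relabel² (x , y) = relabel x , relabel y

  relabel²-involutive : ∀ ω → relabel² (relabel² ω) ≡ ω
  relabel²-involutive (x , y) = cong₂ _,_ (relabel-involutive x) (relabel-involutive y)

  Z-relabel² : ∀ ω i → Z (relabel² ω) i ≡ Z ω (σ i)
  Z-relabel² (x , y) i = cong₂ (λ b c → χ b * χ c)
    (lookup∘tabulate (lookup x ∘ σ) i) (lookup∘tabulate (lookup y ∘ σ) i)

  sum-relabel : ∀ k (f : Subset n → ℕ) → sumˡ (map (f ∘ relabel) (layer n k)) ≡ sumˡ (map f (layer n k))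
  sum-relabel k f = trans (cong sumˡ (map-∘ (layer n k))) (sum-↭ (map⁺ f (map-relabel-layer k)))

  -- Invariance of the law of the pair when the same relabelling acts on both vectors: it is undone
  -- first in the inner sum, then in the outer one.
  sum-relabel² : ∀ k (f : Subset n × Subset n → ℕ) →
    let Ω = cartesianProduct (layer n k) (layer n k) in
    sumˡ (map (f ∘ relabel²) Ω) ≡ sumˡ (map f Ω)
  sum-relabel² k f = begin
    sumˡ (map (f ∘ relabel²) (cartesianProduct L L))
      ≡⟨ sum-map-cartesianProduct (f ∘ relabel²) L L ⟩
    sumˡ (map (λ x → sumˡ (map (λ y → f (relabel x , relabel y)) L)) L)
      ≡⟨ cong sumˡ (map-cong (λ x → sum-relabel k (λ y → f (relabel x , y))) L) ⟩
    sumˡ (map (λ x → sumˡ (map (λ y → f (relabel x , y)) L)) L)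
      ≡⟨ sum-relabel k (λ x → sumˡ (map (λ y → f (x , y)) L)) ⟩
    sumˡ (map (λ x → sumˡ (map (λ y → f (x , y)) L)) L)
      ≡⟨ sum-map-cartesianProduct f L L ⟨
    sumˡ (map f (cartesianProduct L L)) ∎
    where
    open ≡-Reasoning
    L = layer n k

-- Convexity of powers

-- The inner points `x + a`, `x + b` and the outer points `x`, `x + a + b` have equal sums. In the
-- induction, the factor `x` uses the hypothesis, while the factors `a` and `b` multiply powers
-- bounded by the largest one.
^-convex : ∀ d x a b → (x + a) ^ d + (x + b) ^ d ≤ x ^ d + (x + a + b) ^ d
^-convex zero    x a b = ≤-refl
^-convex (suc d) x a b = begin
  (x + a) * A + (x + b) * B         ≡⟨ split x a b A B ⟩
  x * (A + B) + (a * A + b * B)     ≤⟨ +-mono-≤ (*-monoʳ-≤ x (^-convex d x a b))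
                                         (+-mono-≤ (*-monoʳ-≤ a A≤D) (*-monoʳ-≤ b B≤D)) ⟩
  x * (C + D) + (a * D + b * D)     ≡⟨ join x a b C D ⟩
  x * C + (x + a + b) * D           ∎
  where
  open ≤-Reasoning
  A = (x + a) ^ d
  B = (x + b) ^ d
  C = x ^ d
  D = (x + a + b) ^ d
  A≤D : A ≤ D
  A≤D = ^-monoˡ-≤ d (m≤m+n (x + a) b)
  B≤D : B ≤ D
  B≤D = ^-monoˡ-≤ d (+-monoˡ-≤ b (m≤m+n x a))
  split : ∀ x a b A B → (x + a) * A + (x + b) * B ≡ x * (A + B) + (a * A + b * B)
  split = solve-∀
  join : ∀ x a b C D → x * (C + D) + (a * D + b * D) ≡ x * C + (x + a + b) * D
  join = solve-∀

-- A subtraction-free exchange: passing from `q` to `p` gains `d` and loses `c`.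
≤-from-exchange : ∀ {p q c d} → p + c ≡ q + d → c ≤ d → q ≤ p
≤-from-exchange {p} {q} {c} {d} p+c≡q+d c≤d = +-cancelʳ-≤ d q p (begin
  q + d ≡⟨ p+c≡q+d ⟨
  p + c ≤⟨ +-monoʳ-≤ p c≤d ⟩
  p + d ∎)
  where open ≤-Reasoning

-- Equal sums and the upper bound `p′` force `q′` below both `p` and `q`. Hence `p = q′ + x`,
-- `q = q′ + y` and `p′ = q′ + x + y`, the configuration of `^-convex`.
^-majorize : ∀ d {p q p′ q′} → p + q ≡ p′ + q′ → p ≤ p′ → q ≤ p′ → p ^ d + q ^ d ≤ p′ ^ d + q′ ^ d
^-majorize d {p} {q} {p′} {q′} sum≡ p≤p′ q≤p′ = begin
  p ^ d + q ^ d                         ≡⟨ cong₂ (λ y z → y ^ d + z ^ d) p≡ q≡ ⟨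
  (q′ + x) ^ d + (q′ + y) ^ d           ≤⟨ ^-convex d q′ x y ⟩
  q′ ^ d + (q′ + x + y) ^ d             ≡⟨ +-comm (q′ ^ d) _ ⟩
  (q′ + x + y) ^ d + q′ ^ d             ≡⟨ cong (λ z → z ^ d + q′ ^ d) p′≡ ⟩
  p′ ^ d + q′ ^ d                       ∎
  where
  open ≤-Reasoning
  x = p ∸ q′
  y = q ∸ q′
  p≡ : q′ + x ≡ p
  p≡ = m+[n∸m]≡n (≤-from-exchange {p} {q′} sum≡′ q≤p′)
    where sum≡′ = trans sum≡ (+-comm p′ q′)
  q≡ : q′ + y ≡ q
  q≡ = m+[n∸m]≡n (≤-from-exchange {q} {q′} sum≡′ p≤p′)
    where sum≡′ = trans (+-comm q p) (trans sum≡ (+-comm p′ q′))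
  p′≡ : q′ + x + y ≡ p′
  p′≡ = +-cancelʳ-≡ q′ _ _ (trans (regroup q′ x y) (trans (cong₂ _+_ p≡ q≡) sum≡))
    where
    regroup : ∀ q x y → q + x + y + q ≡ q + x + (q + y)
    regroup = solve-∀

-- Compression

module Compress {n : ℕ} (M : Mask n) {u v : Fin n} (u≢v : u ≢ v) where

  private
    a = adj M

  data Role (i : Fin n) : Set where
    isU   : i ≡ u → Role i
    isV   : i ≡ v → Role i
    other : i ≢ u → i ≢ v → Role i

  role : ∀ i → Role i
  role i with i ≟F u | i ≟F v
  ... | yes i≡u | _       = isU i≡u
  ... | no _    | yes i≡v = isV i≡v
  ... | no i≢u  | no i≢v  = other i≢u i≢v

  -- Outside `u` and `v`, the new neighbourhood of `u` is the union of the two old ones and that of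
  -- `v` is their intersection. All other pairs, including `u`, `v` itself, keep their status.
  merge : ∀ {i j} → Role i → Role j → Bool
  merge {i} {j} (isU _)     (other _ _) = a u j ∨ a v j
  merge {i} {j} (isV _)     (other _ _) = a u j ∧ a v j
  merge {i} {j} (other _ _) (isU _)     = a u i ∨ a v i
  merge {i} {j} (other _ _) (isV _)     = a u i ∧ a v i
  merge {i} {j} _           _           = a i j

  merge-sym : ∀ {i j} (r : Role i) (s : Role j) → merge r s ≡ merge s r
  merge-sym (isU _)     (isU _)     = adj-sym M _ _
  merge-sym (isU _)     (isV _)     = adj-sym M _ _
  merge-sym (isV _)     (isU _)     = adj-sym M _ _
  merge-sym (isV _)     (isV _)     = adj-sym M _ _
  merge-sym (other _ _) (other _ _) = adj-sym M _ _
  merge-sym (isU _)     (other _ _) = refl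
  merge-sym (isV _)     (other _ _) = refl
  merge-sym (other _ _) (isU _)     = refl
  merge-sym (other _ _) (isV _)     = refl

  merge-irrefl : ∀ {i} (r : Role i) → merge r r ≡ false
  merge-irrefl (isU _)     = adj-irrefl M _
  merge-irrefl (isV _)     = adj-irrefl M _
  merge-irrefl (other _ _) = adj-irrefl M _

  compress : Mask n
  compress .adj i j      = merge (role i) (role j)
  compress .adj-sym i j  = merge-sym (role i) (role j)
  compress .adj-irrefl i = merge-irrefl (role i)

  swap : ∀ {i} → Role i → Fin n
  swap (isU _)         = v
  swap (isV _)         = u
  swap {i} (other _ _) = i

  -- `role i` does not reduce for a variable `i`; this allows it to be replaced by any role that is
  -- known to hold.
  swap-irrelevant : ∀ {i} (r s : Role i) → swap r ≡ swap s
  swap-irrelevant (isU _)       (isU _)       = refl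
  swap-irrelevant (isV _)       (isV _)       = refl
  swap-irrelevant (other _ _)   (other _ _)   = refl
  swap-irrelevant (isU i≡u)     (isV i≡v)     = contradiction (trans (sym i≡u) i≡v) u≢v
  swap-irrelevant (isV i≡v)     (isU i≡u)     = contradiction (trans (sym i≡u) i≡v) u≢v
  swap-irrelevant (isU i≡u)     (other i≢u _) = contradiction i≡u i≢u
  swap-irrelevant (isV i≡v)     (other _ i≢v) = contradiction i≡v i≢v
  swap-irrelevant (other i≢u _) (isU i≡u)     = contradiction i≡u i≢u
  swap-irrelevant (other _ i≢v) (isV i≡v)     = contradiction i≡v i≢v

  σ : Fin n → Fin n
  σ i = swap (role i)

  σu≡v : σ u ≡ v
  σu≡v = swap-irrelevant (role u) (isU refl)

  σv≡u : σ v ≡ u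
  σv≡u = swap-irrelevant (role v) (isV refl)

  σ-involutive : ∀ i → σ (σ i) ≡ i
  σ-involutive i with role i
  ... | isU refl = σv≡u
  ... | isV refl = σu≡v
  ... | other i≢u i≢v = swap-irrelevant (role i) (other i≢u i≢v)

  σ-permutation : Permutation n n
  σ-permutation = permutation σ σ σ-involutive σ-involutive

  δu δv : ∀ {i} → Role i → ℕ
  δu (isU _) = 1
  δu _       = 0
  δv (isV _) = 1
  δv _       = 0

  δu-on : (r : Role u) → δu r ≡ 1
  δu-on (isU _)       = refl
  δu-on (isV u≡v)     = contradiction u≡v u≢v
  δu-on (other u≢u _) = contradiction refl u≢u

  δv-on : (r : Role v) → δv r ≡ 1
  δv-on (isU v≡u)     = contradiction (sym v≡u) u≢v
  δv-on (isV _)       = refl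
  δv-on (other _ v≢v) = contradiction refl v≢v

  δu-off : ∀ {i} (r : Role i) → i ≢ u → δu r ≡ 0
  δu-off (isU i≡u)   i≢u = contradiction i≡u i≢u
  δu-off (isV _)     i≢u = refl
  δu-off (other _ _) i≢u = refl

  δv-off : ∀ {i} (r : Role i) → i ≢ v → δv r ≡ 0
  δv-off (isU _)     i≢v = refl
  δv-off (isV i≡v)   i≢v = contradiction i≡v i≢v
  δv-off (other _ _) i≢v = refl

  -- Indicators of the vertices other than u and v that are adjacent to exactly
  -- one of them: to v for movable, to u for movableσ.
  movable movableσ : ∀ {i} → Role i → ℕ
  movable {i} (other _ _) = χ (a v i ∧ not (a u i))
  movable     _           = 0
  movableσ {i} (other _ _) = χ (a u i ∧ not (a v i))
  movableσ     _           = 0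

  -- Compression deletes the star at `v` with leaves the movable vertices and adds the star at `u`
  -- with the same leaves. Both stars are added to opposite sides to avoid subtraction.
  merge-shift : ∀ {i j} (r : Role i) (s : Role j) →
    χ (merge r s) + (δv r * movable s + δv s * movable r) ≡
    χ (a i j) + (δu r * movable s + δu s * movable r)
  merge-shift (isU _)     (isU _)     = refl
  merge-shift (isU _)     (isV _)     = refl
  merge-shift (isV _)     (isU _)     = refl
  merge-shift (isV _)     (isV _)     = refl
  merge-shift (other _ _) (other _ _) = refl
  merge-shift {i} {j} (isU refl) (other _ _) with a u j | a v j
  ... | true  | true  = refl
  ... | true  | false = refl
  ... | false | true  = refl
  ... | false | false = refl
  merge-shift {i} {j} (isV refl) (other _ _) with a u j | a v j
  ... | true  | true  = refl
  ... | true  | false = refl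
  ... | false | true  = refl
  ... | false | false = refl
  merge-shift {i} {j} (other _ _) (isU refl) rewrite adj-sym M i u with a u i | a v i
  ... | true  | true  = refl
  ... | true  | false = refl
  ... | false | true  = refl
  ... | false | false = refl
  merge-shift {i} {j} (other _ _) (isV refl) rewrite adj-sym M i v with a u i | a v i
  ... | true  | true  = refl
  ... | true  | false = refl
  ... | false | true  = refl
  ... | false | false = refl

  -- M and its image under the transposition of u and v have the same compression.
  merge-shiftσ : ∀ {i j} (r : Role i) (s : Role j) →
    χ (merge r s) + (δv r * movableσ s + δv s * movableσ r) ≡
    χ (a (swap r) (swap s)) + (δu r * movableσ s + δu s * movableσ r)
  merge-shiftσ (isU refl)  (isU refl)  rewrite adj-irrefl M u | adj-irrefl M v = refl
  merge-shiftσ (isU refl)  (isV refl)  rewrite adj-sym M u v = refl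
  merge-shiftσ (isV refl)  (isU refl)  rewrite adj-sym M u v = refl
  merge-shiftσ (isV refl)  (isV refl)  rewrite adj-irrefl M u | adj-irrefl M v = refl
  merge-shiftσ (other _ _) (other _ _) = refl
  merge-shiftσ {i} {j} (isU refl) (other _ _) with a u j | a v j
  ... | true  | true  = refl
  ... | true  | false = refl
  ... | false | true  = refl
  ... | false | false = refl
  merge-shiftσ {i} {j} (isV refl) (other _ _) with a u j | a v j
  ... | true  | true  = refl
  ... | true  | false = refl
  ... | false | true  = refl
  ... | false | false = refl
  merge-shiftσ {i} {j} (other _ _) (isU refl) rewrite adj-sym M i v with a u i | a v i
  ... | true  | true  = refl
  ... | true  | false = refl
  ... | false | true  = refl
  ... | false | false = refl
  merge-shiftσ {i} {j} (other _ _) (isV refl) rewrite adj-sym M i u with a u i | a v i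
  ... | true  | true  = refl
  ... | true  | false = refl
  ... | false | true  = refl
  ... | false | false = refl

  private
    a′ = adj compress

    e eσ : Fin n → ℕ
    e  i = movable (role i)
    eσ i = movableσ (role i)

  -- `merge-shift` summed against `f`. The choice `f = 1` controls the size, `f i j = g i` the
  -- potential, and `f i j = z i * z j` the quadratic form.
  ∑∑-compress : ∀ f →
    ∑∑ a′ f + (∑[ w < n ] (e w * (f v w + f w v))) ≡ ∑∑ a f + (∑[ w < n ] (e w * (f u w + f w u)))
  ∑∑-compress f = begin
    ∑∑ a′ f + (∑[ w < n ] (e w * (f v w + f w v)))
      ≡⟨ cong₂ _+_ refl (∑∑-attach (δv-on (role v)) (λ i → δv-off (role i)) e f) ⟨
    ∑∑ a′ f + _
      ≡⟨ ∑∑-+ a′ (λ i j → δv (role i) * e j + δv (role j) * e i) f ⟩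
    (∑[ i < n ] ∑[ j < n ] ((χ (a′ i j) + (δv (role i) * e j + δv (role j) * e i)) * f i j))
      ≡⟨ sum-cong-≗ (λ i → sum-cong-≗ λ j → cong (_* f i j) (merge-shift (role i) (role j))) ⟩
    (∑[ i < n ] ∑[ j < n ] ((χ (a i j) + (δu (role i) * e j + δu (role j) * e i)) * f i j))
      ≡⟨ ∑∑-+ a (λ i j → δu (role i) * e j + δu (role j) * e i) f ⟨
    ∑∑ a f + _
      ≡⟨ cong₂ _+_ refl (∑∑-attach (δu-on (role u)) (λ i → δu-off (role i)) e f) ⟩
    ∑∑ a f + (∑[ w < n ] (e w * (f u w + f w u))) ∎
    where open ≡-Reasoning

  ∑∑-compressσ : ∀ f →
    ∑∑ a′ f + (∑[ w < n ] (eσ w * (f v w + f w v))) ≡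
    ∑∑ (λ i j → a (σ i) (σ j)) f + (∑[ w < n ] (eσ w * (f u w + f w u)))
  ∑∑-compressσ f = begin
    ∑∑ a′ f + (∑[ w < n ] (eσ w * (f v w + f w v)))
      ≡⟨ cong₂ _+_ refl (∑∑-attach (δv-on (role v)) (λ i → δv-off (role i)) eσ f) ⟨
    ∑∑ a′ f + _
      ≡⟨ ∑∑-+ a′ (λ i j → δv (role i) * eσ j + δv (role j) * eσ i) f ⟩
    (∑[ i < n ] ∑[ j < n ] ((χ (a′ i j) + (δv (role i) * eσ j + δv (role j) * eσ i)) * f i j))
      ≡⟨ sum-cong-≗ (λ i → sum-cong-≗ λ j → cong (_* f i j) (merge-shiftσ (role i) (role j))) ⟩
    (∑[ i < n ] ∑[ j < n ] ((χ (a (σ i) (σ j)) + (δu (role i) * eσ j + δu (role j) * eσ i)) * f i j))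
      ≡⟨ ∑∑-+ (λ i j → a (σ i) (σ j)) (λ i j → δu (role i) * eσ j + δu (role j) * eσ i) f ⟨
    ∑∑ (λ i j → a (σ i) (σ j)) f + _
      ≡⟨ cong₂ _+_ refl (∑∑-attach (δu-on (role u)) (λ i → δu-off (role i)) eσ f) ⟩
    ∑∑ (λ i j → a (σ i) (σ j)) f + (∑[ w < n ] (eσ w * (f u w + f w u))) ∎
    where open ≡-Reasoning

  degree-compress : ∀ i → degree a′ i + δv (role i) * sum e ≡ degree a i + δu (role i) * sum e
  -- A movable vertex `i` trades its neighbour `v` for `u`, so `e i` occurs on both sides and
  -- cancels.
  degree-compress i = +-cancelʳ-≡ (e i) _ _ (begin
    degree a′ i + δv (role i) * sum e + e i
      ≡⟨ row a′ δv (δv-on (role v)) (λ j → δv-off (role j)) ⟩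
    (∑[ j < n ] (χ (a′ i j) + (δv (role i) * e j + δv (role j) * e i)))
      ≡⟨ sum-cong-≗ (λ j → merge-shift (role i) (role j)) ⟩
    (∑[ j < n ] (χ (a i j) + (δu (role i) * e j + δu (role j) * e i)))
      ≡⟨ row a δu (δu-on (role u)) (λ j → δu-off (role j)) ⟨
    degree a i + δu (role i) * sum e + e i ∎)
    where
    open ≡-Reasoning
    row : ∀ b (δ : ∀ {i} → Role i → ℕ) {x} → δ (role x) ≡ 1 → (∀ j → j ≢ x → δ (role j) ≡ 0) →
      degree b i + δ (role i) * sum e + e i ≡
      ∑[ j < n ] (χ (b i j) + (δ (role i) * e j + δ (role j) * e i))
    row b δ {x} on off = sym (begin
      (∑[ j < n ] (χ (b i j) + (δ (role i) * e j + δ (role j) * e i)))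
        ≡⟨ ∑-distrib-+ (λ j → χ (b i j)) _ ⟩
      degree b i + (∑[ j < n ] (δ (role i) * e j + δ (role j) * e i))
        ≡⟨ cong₂ _+_ refl (∑-distrib-+ (λ j → δ (role i) * e j) _) ⟩
      degree b i + ((∑[ j < n ] (δ (role i) * e j)) + (∑[ j < n ] (δ (role j) * e i)))
        ≡⟨ cong₂ _+_ (refl {x = degree b i}) (cong₂ _+_ (sym (*-distribˡ-sum (δ (role i)) e))
             (trans (∑-single x λ j j≢x → cong (_* e i) (off j j≢x))
                    (trans (cong (_* e i) on) (*-identityˡ (e i))))) ⟩
      degree b i + (δ (role i) * sum e + e i)
        ≡⟨ +-assoc (degree b i) _ _ ⟨
      degree b i + δ (role i) * sum e + e i ∎)

  movable≤adj : ∀ {i} (r : Role i) → movable r ≤ χ (a v i)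
  movable≤adj (isU _) = z≤n
  movable≤adj (isV _) = z≤n
  movable≤adj {i} (other _ _) with a v i | a u i
  ... | false | _     = z≤n
  ... | true  | true  = z≤n
  ... | true  | false = s≤s z≤n

  movable≡1 : ∀ {w} (r : Role w) → w ≢ u → T (a v w) → ¬ T (a u w) → movable r ≡ 1
  movable≡1 (isU w≡u)   w≢u vw ¬uw = contradiction w≡u w≢u
  movable≡1 (isV refl)  w≢u vw ¬uw = case subst T (adj-irrefl M v) vw of λ ()
  movable≡1 {w} (other _ _) w≢u vw ¬uw with a v w | a u w
  ... | true  | false = refl
  ... | true  | true  = contradiction tt ¬uw

  -- Only the degree of `u` can grow, and by at most the degree of `v`.
  degree-compress-≤ : ∀ {m} → degree a u + degree a v ≤ m → (∀ i → degree a i ≤ m) →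
    ∀ i → degree a′ i ≤ m
  degree-compress-≤ {m} uv≤m deg≤m i = begin
    degree a′ i                      ≤⟨ m≤m+n _ _ ⟩
    degree a′ i + δv (role i) * sum e ≡⟨ degree-compress i ⟩
    degree a i + δu (role i) * sum e  ≤⟨ bound (role i) ⟩
    m                                ∎
    where
    open ≤-Reasoning
    bound : (r : Role i) → degree a i + δu r * sum e ≤ m
    bound (isV _)     = ≤-trans (≤-reflexive (+-identityʳ _)) (deg≤m i)
    bound (other _ _) = ≤-trans (≤-reflexive (+-identityʳ _)) (deg≤m i)
    bound (isU refl)  = ≤-trans
      (+-monoʳ-≤ (degree a i) (≤-trans (≤-reflexive (*-identityˡ (sum e))) (∑-mono-≤ λ j → movable≤adj (role j))))
      uv≤m

  size-compress : size compress ≡ size M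
  size-compress = *-cancelˡ-≡ _ _ 2 (trans (2size compress) (trans
    (+-cancelʳ-≡ _ _ _ (∑∑-compress (λ _ _ → 1))) (sym (2size M))))

  -- The double sum is the degree-weighted sum of `g`. Each moved edge replaces a contribution `g v`
  -- by `g u`, and the edge from `v` to `w` is one that moves, which makes the drop strict.
  potential-compress : (g : Fin n → ℕ) → g u < g v →
    ∀ w → w ≢ u → T (a v w) → ¬ T (a u w) → ∑∑ a′ (λ i _ → g i) < ∑∑ a (λ i _ → g i)
  potential-compress g gu<gv w w≢u vw ¬uw = +-cancelʳ-< _ _ _ (begin-strict
    ∑∑ a′ (λ i _ → g i) + (∑[ x < n ] (e x * (g u + g x)))
      <⟨ +-monoʳ-< (∑∑ a′ (λ i _ → g i))
           (∑-mono-< (λ x → *-monoʳ-≤ (e x) (+-monoˡ-≤ (g x) (<⇒≤ gu<gv))) w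
             (subst (λ k → k * (g u + g w) < k * (g v + g w)) (sym (movable≡1 (role w) w≢u vw ¬uw))
               (*-monoʳ-< 1 (+-monoˡ-< (g w) gu<gv)))) ⟩
    ∑∑ a′ (λ i _ → g i) + (∑[ x < n ] (e x * (g v + g x)))
      ≡⟨ ∑∑-compress (λ i _ → g i) ⟩
    ∑∑ a (λ i _ → g i) + (∑[ x < n ] (e x * (g u + g x))) ∎)
    where open ≤-Reasoning

  -- Quadratic forms under compression

  private
    Q : (Fin n → Fin n → Bool) → (Fin n → ℕ) → ℕ
    Q b z = ∑∑ b (λ i j → z i * z j)

  link-mono : ∀ (h z : Fin n → ℕ) → z v ≤ z u →
    (∑[ w < n ] (h w * (z v * z w + z w * z v))) ≤ (∑[ w < n ] (h w * (z u * z w + z w * z u)))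
  link-mono h z zv≤zu = ∑-mono-≤ λ w → *-monoʳ-≤ (h w) (+-mono-≤ (*-monoˡ-≤ (z w) zv≤zu) (*-monoʳ-≤ (z w) zv≤zu))

  Q≤Q-compress : ∀ z → z v ≤ z u → Q a z ≤ Q a′ z
  Q≤Q-compress z zv≤zu = ≤-from-exchange {Q a′ z} {Q a z} (∑∑-compress (λ i j → z i * z j)) (link-mono e z zv≤zu)

  Qσ≡ : ∀ z → Q a (z ∘ σ) ≡ Q (λ i j → a (σ i) (σ j)) z
  Qσ≡ z = trans (sum-permute (λ i → sum (λ j → χ (a i j) * (z (σ i) * z (σ j)))) σ-permutation)
    (sum-cong-≗ λ i → trans (sum-permute (λ j → χ (a (σ i) j) * (z (σ (σ i)) * z (σ j))) σ-permutation)
      (sum-cong-≗ λ j → cong₂ (λ x y → χ (a (σ i) (σ j)) * (z x * z y)) (σ-involutive i) (σ-involutive j)))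

  -- Evaluating `M` at `z ∘ σ` is evaluating the transposed graph at `z`. That graph has the same
  -- compression, so it too only moves edges towards the larger coordinate.
  Qσ≤Q-compress : ∀ z → z v ≤ z u → Q a (z ∘ σ) ≤ Q a′ z
  Qσ≤Q-compress z zv≤zu = subst (_≤ Q a′ z) (sym (Qσ≡ z))
    (≤-from-exchange {Q a′ z} (∑∑-compressσ (λ i j → z i * z j)) (link-mono eσ z zv≤zu))

  -- The exchange identity is used at `z` and at `z ∘ σ`. As `σ` exchanges the values at `u` and
  -- `v`, the gain at one point is the loss at the other.
  Q-balance : ∀ z → Q a z + Q a (z ∘ σ) ≡ Q a′ z + Q a′ (z ∘ σ)
  Q-balance z = cancel {Q a z} {Q a (z ∘ σ)} {Q a′ z} (∑∑-compress (λ i j → z i * z j)) (begin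
    Q a′ (z ∘ σ) + (∑[ w < n ] (e w * (z u * z w + z w * z u)))
      ≡⟨ cong₂ _+_ refl (link u v σv≡u) ⟨
    Q a′ (z ∘ σ) + _
      ≡⟨ ∑∑-compress (λ i j → z (σ i) * z (σ j)) ⟩
    Q a (z ∘ σ) + _
      ≡⟨ cong₂ _+_ refl (link v u σu≡v) ⟩
    Q a (z ∘ σ) + (∑[ w < n ] (e w * (z v * z w + z w * z v))) ∎)
    where
    open ≡-Reasoning
    link : ∀ x y → σ y ≡ x →
      (∑[ w < n ] (e w * (z (σ y) * z (σ w) + z (σ w) * z (σ y)))) ≡ (∑[ w < n ] (e w * (z x * z w + z w * z x)))
    link x y refl = sum-cong-≗ λ w → step w (role w)
      where
      -- `movable` vanishes at `u` and `v`, the only vertices that `σ` moves.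
      step : ∀ w (r : Role w) →
        movable r * (z x * z (swap r) + z (swap r) * z x) ≡ movable r * (z x * z w + z w * z x)
      step w (isU _)     = refl
      step w (isV _)     = refl
      step w (other _ _) = refl
    cancel : ∀ {p q p′ q′ c d} → p′ + c ≡ p + d → q′ + d ≡ q + c → p + q ≡ p′ + q′
    cancel {p} {q} {p′} {q′} {c} {d} E₁ E₂ = +-cancelʳ-≡ (c + d) _ _ (begin
      p + q + (c + d)     ≡⟨ regroup p q c d ⟩
      p + d + (q + c)     ≡⟨ cong₂ _+_ E₁ E₂ ⟨
      p′ + c + (q′ + d)   ≡⟨ regroup p′ q′ d c ⟨
      p′ + q′ + (d + c)   ≡⟨ cong₂ _+_ (refl {x = p′ + q′}) (+-comm d c) ⟩
      p′ + q′ + (c + d)   ∎)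
      where
      regroup : ∀ p q c d → p + q + (c + d) ≡ p + d + (q + c)
      regroup = solve-∀

  -- Moments under compression

  open Relabel σ σ-involutive

  private
    Q-cong : ∀ b {y z : Fin n → ℕ} → y ≗ z → Q b y ≡ Q b z
    Q-cong b y≗z = sum-cong-≗ λ i → sum-cong-≗ λ j → cong₂ (λ y z → χ (b i j) * (y * z)) (y≗z i) (y≗z j)

    2pairSum-relabel² : ∀ N ω → 2 * pairSum N (relabel² ω) ≡ Q (adj N) (Z ω ∘ σ)
    2pairSum-relabel² N ω = trans (2pairSum N (relabel² ω)) (Q-cong (adj N) (Z-relabel² ω))

  pairSum-≤ : ∀ ω → Z ω v ≤ Z ω u →
    pairSum M ω ≤ pairSum compress ω × pairSum M (relabel² ω) ≤ pairSum compress ω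
  pairSum-≤ ω Zv≤Zu =
    *-cancelˡ-≤ 2 (subst₂ _≤_ (sym (2pairSum M ω)) (sym (2pairSum compress ω)) (Q≤Q-compress (Z ω) Zv≤Zu)) ,
    *-cancelˡ-≤ 2 (subst₂ _≤_ (sym (2pairSum-relabel² M ω)) (sym (2pairSum compress ω)) (Qσ≤Q-compress (Z ω) Zv≤Zu))

  pairSum-balance : ∀ ω →
    pairSum M ω + pairSum M (relabel² ω) ≡ pairSum compress ω + pairSum compress (relabel² ω)
  pairSum-balance ω = *-cancelˡ-≡ _ _ 2 (begin
    2 * (pairSum M ω + pairSum M (relabel² ω)) ≡⟨ *-distribˡ-+ 2 (pairSum M ω) _ ⟩
    2 * pairSum M ω + 2 * pairSum M (relabel² ω) ≡⟨ cong₂ _+_ (2pairSum M ω) (2pairSum-relabel² M ω) ⟩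
    Q a (Z ω) + Q a (Z ω ∘ σ) ≡⟨ Q-balance (Z ω) ⟩
    Q a′ (Z ω) + Q a′ (Z ω ∘ σ) ≡⟨ cong₂ _+_ (2pairSum compress ω) (2pairSum-relabel² compress ω) ⟨
    2 * pairSum compress ω + 2 * pairSum compress (relabel² ω) ≡⟨ *-distribˡ-+ 2 (pairSum compress ω) _ ⟨
    2 * (pairSum compress ω + pairSum compress (relabel² ω)) ∎)
    where open ≡-Reasoning

  pairSum^-≤ : ∀ d ω →
    pairSum M ω ^ d + pairSum M (relabel² ω) ^ d ≤ pairSum compress ω ^ d + pairSum compress (relabel² ω) ^ d
  pairSum^-≤ d ω with ≤-total (Z ω v) (Z ω u)
  ... | inj₁ Zv≤Zu = let p≤ , q≤ = pairSum-≤ ω Zv≤Zu in ^-majorize d (pairSum-balance ω) p≤ q≤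
  -- At `relabel² ω` the two coordinates are exchanged, so the bounds hold there and the dominating
  -- value is `pairSum compress (relabel² ω)`.
  ... | inj₂ Zu≤Zv = ≤-trans
    (^-majorize d (trans (pairSum-balance ω) (+-comm (pairSum compress ω) _)) q≤ p≤)
    (≤-reflexive (+-comm (pairSum compress (relabel² ω) ^ d) _))
    where
    swapped : Z (relabel² ω) v ≤ Z (relabel² ω) u
    swapped = subst₂ _≤_ (trans (cong (Z ω) (sym σv≡u)) (sym (Z-relabel² ω v)))
                         (trans (cong (Z ω) (sym σu≡v)) (sym (Z-relabel² ω u))) Zu≤Zv
    p≤ = proj₁ (pairSum-≤ (relabel² ω) swapped)
    q≤ = subst (λ ω′ → pairSum M ω′ ≤ pairSum compress (relabel² ω)) (relabel²-involutive ω)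
           (proj₂ (pairSum-≤ (relabel² ω) swapped))

  -- Relabelling preserves the sum over the sample space, so twice the sum pairs every `ω` with
  -- `relabel² ω`, and the pointwise bound applies to each pair.
  ∑pairSum^-≤ : ∀ k d →
    let Ω = cartesianProduct (layer n k) (layer n k) in
    sumˡ (map (λ ω → pairSum M ω ^ d) Ω) ≤ sumˡ (map (λ ω → pairSum compress ω ^ d) Ω)
  ∑pairSum^-≤ k d = *-cancelˡ-≤ 2 (subst₂ _≤_ (sym (double M)) (sym (double compress))
      (sum-map-mono-≤ (pairSum^-≤ d) Ω))
    where
    Ω = cartesianProduct (layer n k) (layer n k)
    double : ∀ N → 2 * sumˡ (map (λ ω → pairSum N ω ^ d) Ω) ≡
      sumˡ (map (λ ω → pairSum N ω ^ d + pairSum N (relabel² ω) ^ d) Ω)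
    double N = begin
      2 * S                 ≡⟨ cong₂ _+_ refl (+-identityʳ S) ⟩
      S + S                 ≡⟨ cong₂ _+_ refl (sum-relabel² k f) ⟨
      S + sumˡ (map (f ∘ relabel²) Ω) ≡⟨ sum-map-+ f (f ∘ relabel²) Ω ⟨
      sumˡ (map (λ ω → f ω + f (relabel² ω)) Ω) ∎
      where
      open ≡-Reasoning
      f = λ ω → pairSum N ω ^ d
      S = sumˡ (map f Ω)

-- Monotonicity of LDUB in the moments

-- `_/_` normalises its result, so the comparison is made among unnormalised rationals, where the
-- denominators are visible.
/1-mono-≤ : ∀ {m n} → m ≤ n → (+ m / 1) ≤ℚ (+ n / 1)
/1-mono-≤ {m} {n} m≤n = ℚ.toℚᵘ-cancel-≤
  (ℚᵘ.≤-respˡ-≃ (ℚᵘ.≃-sym (ℚ.toℚᵘ-fromℚᵘ (ℚᵘ.mkℚᵘ (+ m) 0)))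
  (ℚᵘ.≤-respʳ-≃ (ℚᵘ.≃-sym (ℚ.toℚᵘ-fromℚᵘ (ℚᵘ.mkℚᵘ (+ n) 0)))
  (ℚᵘ.*≤* (ℤ.*-monoʳ-≤-nonNeg (+ 1) (ℤ.+≤+ m≤n)))))

/1-homo-+ : ∀ m n → (+ (m + n) / 1) ≡ (+ m / 1) +ℚ (+ n / 1)
/1-homo-+ m n = ℚ.toℚᵘ-injective (begin
  ℚ.toℚᵘ (+ (m + n) / 1)                       ≈⟨ ℚ.toℚᵘ-fromℚᵘ (ℚᵘ.mkℚᵘ (+ (m + n)) 0) ⟩
  ℚᵘ.mkℚᵘ (+ (m + n)) 0                        ≈⟨ ℚᵘ.*≡* (cong (ℤ._* (+ 1)) (sym (cong₂ ℤ._+_ (ℤ.*-identityʳ (+ m)) (ℤ.*-identityʳ (+ n))))) ⟩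
  ℚᵘ.mkℚᵘ (+ m) 0 ℚᵘ.+ ℚᵘ.mkℚᵘ (+ n) 0         ≈⟨ ℚᵘ.+-cong (ℚ.toℚᵘ-fromℚᵘ (ℚᵘ.mkℚᵘ (+ m) 0)) (ℚ.toℚᵘ-fromℚᵘ (ℚᵘ.mkℚᵘ (+ n) 0)) ⟨
  ℚ.toℚᵘ (+ m / 1) ℚᵘ.+ ℚ.toℚᵘ (+ n / 1)       ≈⟨ ℚ.toℚᵘ-homo-+ (+ m / 1) (+ n / 1) ⟨
  ℚ.toℚᵘ ((+ m / 1) +ℚ (+ n / 1))              ∎)
  where open import Relation.Binary.Reasoning.Setoid ℚᵘ.≃-setoid

sumℚ-/1 : ∀ {A : Set} (f : A → ℕ) xs → sumℚ (map (λ x → + f x / 1) xs) ≡ + sumˡ (map f xs) / 1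
sumℚ-/1 f []       = refl
sumℚ-/1 f (x ∷ xs) = trans (cong ((+ f x / 1) +ℚ_) (sumℚ-/1 f xs)) (sym (/1-homo-+ (f x) _))

sumℚ-mono-≤ : ∀ {A : Set} {f g : A → ℚ.ℚ} → (∀ x → f x ≤ℚ g x) → ∀ xs → sumℚ (map f xs) ≤ℚ sumℚ (map g xs)
sumℚ-mono-≤ f≤g []       = ℚ.≤-refl
sumℚ-mono-≤ f≤g (x ∷ xs) = ℚ.+-mono-≤ (f≤g x) (sumℚ-mono-≤ f≤g xs)

𝔼-mono-≤ : ∀ {A : Set} (Ω : List A) (f g : A → ℕ) → sumˡ (map f Ω) ≤ sumˡ (map g Ω) →
  𝔼 Ω (λ ω → + f ω / 1) ≤ℚ 𝔼 Ω (λ ω → + g ω / 1)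
𝔼-mono-≤ []          f g _   = ℚ.≤-refl
𝔼-mono-≤ Ω@(_ ∷ ω) f g f≤g =
  ℚ.*-monoʳ-≤-nonNeg (+ 1 / suc (length ω)) {{ℚ.normalize-nonNeg 1 (suc (length ω))}}
    (subst₂ _≤ℚ_ (sym (sumℚ-/1 f Ω)) (sym (sumℚ-/1 g Ω)) (/1-mono-≤ f≤g))

LDUB-mono-≤ : ∀ {n} k D (M N : Mask n) → (∀ d → moment k M d ≤ℚ moment k N d) → LDUB k D n M ≤ℚ LDUB k D n N
LDUB-mono-≤ k D M N M≤N = ℚ.+-monoʳ-≤ ℚ.1ℚ (sumℚ-mono-≤
  (λ d → ℚ.*-monoˡ-≤-nonNeg (_/_ (+ 1) (suc d !) {{suc d !≢0}})
           {{ℚ.normalize-nonNeg 1 (suc d !) {{suc d !≢0}}}} (M≤N (suc d))) (upTo D))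

LDUB-compress : ∀ {n} k D (M : Mask n) {u v} (u≢v : u ≢ v) →
  LDUB k D n M ≤ℚ LDUB k D n (Compress.compress M u≢v)
LDUB-compress {n} k D M u≢v = LDUB-mono-≤ k D M (Compress.compress M u≢v) λ d →
  𝔼-mono-≤ (cartesianProduct (layer n k) (layer n k)) _ _ (Compress.∑pairSum^-≤ M u≢v k d)

-- Stable masks

Low : ∀ {n} → ℕ → Mask n → Fin n → Set
Low t M i = degree (adj M) i < t

-- The vertex `w` certifies that compressing `v` into `u` moves an edge. Requiring `v <F u` fixes
-- the direction of compression, so that a potential can decrease.
Unstable : ∀ {n} → ℕ → Mask n → Fin n → Fin n → Fin n → Set
Unstable t M u v w = v <F u × Low t M u × Low t M v × w ≢ u × T (adj M v w) × ¬ T (adj M u w)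

unstable? : ∀ {n} t (M : Mask n) → Dec (∃ λ u → ∃ λ v → ∃ λ w → Unstable t M u v w)
unstable? t M = any? λ u → any? λ v → any? λ w →
  (v <?F u) ×-dec (degree (adj M) u <? t) ×-dec (degree (adj M) v <? t) ×-dec
  ¬? (w ≟F u) ×-dec T? (adj M v w) ×-dec ¬? (T? (adj M u w))

Stable : ∀ {n} → ℕ → Mask n → Set
Stable t M = ∀ u v → v <F u → Low t M u → Low t M v → ∀ w → w ≢ u → T (adj M v w) → T (adj M u w)

-- Strictly decreasing in the index, so moving edges to the larger index lowers the weighted degree
-- sum.
weight : ∀ {n} → Fin n → ℕ
weight {n} i = n ∸ toℕ i

record Stabilisation {n : ℕ} (k D t : ℕ) (M : Mask n) : Set where
  constructor stabilisation
  field
    mask    : Mask n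
    LDUB≤   : LDUB k D n M ≤ℚ LDUB k D n mask
    size≡   : size mask ≡ size M
    degree≤ : ∀ i → degree (adj mask) i ≤ 2 * t
    stable  : Stable t mask

compress-stabilisation : ∀ {n} k D t (M : Mask n) {u v} (u≢v : u ≢ v) →
  Stabilisation k D t (Compress.compress M u≢v) → Stabilisation k D t M
compress-stabilisation k D t M u≢v (stabilisation N LDUB≤ size≡ degree≤ stable) =
  stabilisation N (ℚ.≤-trans (LDUB-compress k D M u≢v) LDUB≤)
    (trans size≡ (Compress.size-compress M u≢v)) degree≤ stable

stabilise : ∀ {n} k D t (M : Mask n) → (∀ i → degree (adj M) i ≤ 2 * t) →
  Acc _<_ (∑∑ (adj M) (λ i _ → weight i)) → Stabilisation k D t M
stabilise k D t M deg≤2t (acc rec) with unstable? t M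
... | no stable = stabilisation M ℚ.≤-refl refl deg≤2t
      λ u v v<u lu lv w w≢u vw → decidable-stable (T? (adj M u w))
        λ ¬uw → stable (u , v , w , v<u , lu , lv , w≢u , vw , ¬uw)
... | yes (u , v , w , v<u , lu , lv , w≢u , vw , ¬uw) =
  compress-stabilisation k D t M u≢v (stabilise k D t (Compress.compress M u≢v)
    -- Both degrees are below `t`, so their sum is at most `2 * t`, which unfolds to `t + (t + 0)`.
    (Compress.degree-compress-≤ M u≢v (+-mono-≤ (<⇒≤ lu) (≤-trans (<⇒≤ lv) (m≤m+n t 0))) deg≤2t)
    (rec (Compress.potential-compress M u≢v weight (∸-monoʳ-< v<u (toℕ≤n u)) w w≢u vw ¬uw)))
  where
  u≢v : u ≢ v
  u≢v u≡v = <-irrefl (cong toℕ (sym u≡v)) v<u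

-- Counting the vertices

T⇒≡true : ∀ {b} → T b → b ≡ true
T⇒≡true {true} _ = refl

module _ {n : ℕ} (M : Mask n) where

  private
    a = adj M

    neighbour? : ∀ v → Dec (∃ λ w → T (a w v))
    neighbour? v = any? λ w → T? (a w v)

  lookup-V : ∀ v → lookup (V M) v ≡ does (neighbour? v)
  lookup-V v = lookup∘tabulate (λ v → does (neighbour? v)) v

  -- Every neighbour of a vertex lies in `V M`, so the intersection in `deg` loses nothing. Vertices
  -- outside `V M` have degree 0.
  deg≤⇒degree≤ : ∀ {m} → (∀ v → v ∈ V M → deg M v ≤ m) → ∀ v → degree a v ≤ m
  deg≤⇒degree≤ {m} deg≤m v with neighbour? v in eq
  ... | yes _ = ≤-trans degree≤deg (deg≤m v (lookup⇒[]= v (V M) (trans (lookup-V v) (cong does eq))))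
    where
    χ≤ : ∀ w → χ (a v w) ≤ χ (lookup (V M ∩ tabulate (λ w → a w v)) w)
    χ≤ w with a v w in vw
    ... | false = z≤n
    ... | true rewrite lookup-zipWith _∧_ w (V M) (tabulate (λ w → a w v))
          | lookup-V w | lookup∘tabulate (λ w → a w v) w | adj-sym M w v | vw
          | dec-true (neighbour? w) (v , subst T (sym vw) tt) = s≤s z≤n
    degree≤deg : degree a v ≤ deg M v
    degree≤deg = ≤-trans (∑-mono-≤ χ≤) (≤-reflexive (sym (∣∣≡∑χ (V M ∩ tabulate (λ w → a w v)))))
  ... | no isolated = ≤-trans (≤-reflexive (∑-zero χ≡0)) z≤n
    where
    χ≡0 : ∀ w → χ (a v w) ≡ 0
    χ≡0 w with a v w in vw
    ... | false = refl
    ... | true  = contradiction (w , subst T (trans (sym vw) (adj-sym M v w)) tt) isolated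

  high : ℕ → Fin n → Bool
  high t i = does (t ≤? degree a i)

  -- Markov's inequality for the degree sequence, whose sum is twice the number of edges.
  high*t≤2size : ∀ t → (∑[ i < n ] χ (high t i)) * t ≤ 2 * size M
  high*t≤2size t = begin
    (∑[ i < n ] χ (high t i)) * t   ≡⟨ *-distribʳ-sum t (χ ∘ high t) ⟩
    (∑[ i < n ] (χ (high t i) * t)) ≤⟨ ∑-mono-≤ bound ⟩
    (∑[ i < n ] degree a i)         ≡⟨ ∑degree M ⟩
    2 * size M                      ∎
    where
    open ≤-Reasoning
    bound : ∀ i → χ (high t i) * t ≤ degree a i
    bound i with t ≤? degree a i
    ... | yes t≤ rewrite dec-true (t ≤? degree a i) t≤ = ≤-trans (≤-reflexive (*-identityˡ t)) t≤
    ... | no t≰ rewrite dec-false (t ≤? degree a i) t≰ = z≤n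

  private
    LowVertex : ℕ → Fin n → Set
    LowVertex t v = Low t M v × ∃ λ w → T (a w v)

    lowVertex? : ∀ t v → Dec (LowVertex t v)
    lowVertex? t v = (degree a v <? t) ×-dec neighbour? v

  -- If v is the first non-isolated low vertex and w is a neighbour of v, then by
  -- stability w is adjacent or equal to every non-isolated low vertex.
  low-vertices-covered : ∀ {t} → Stable t M →
    (∀ i → ¬ LowVertex t i) ⊎ (∃ λ w → ∀ i → LowVertex t i → i ≡ w ⊎ T (a w i))
  low-vertices-covered {t} stable with all? (λ i → ¬? (lowVertex? t i))
  ... | yes none = inj₁ none
  ... | no ¬none with v , ¬¬low , before ← ¬∀⟶∃¬-smallest n (¬_ ∘ LowVertex t) (λ i → ¬? (lowVertex? t i)) ¬none
      with lv , w , wv ← decidable-stable (lowVertex? t v) ¬¬low = inj₂ (w , covered)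
    where
    vw : T (a v w)
    vw = subst T (adj-sym M w v) wv
    covered : ∀ i → LowVertex t i → i ≡ w ⊎ T (a w i)
    covered i low@(li , _) with <-cmp i v
    -- `before` ranges over `Fin (toℕ v)`, so `i` is rebuilt there from `i<v`.
    ... | tri< i<v _ _ = contradiction low
            (subst (¬_ ∘ LowVertex t) (toℕ-injective (trans (toℕ-inject (fromℕ< i<v)) (toℕ-fromℕ< i<v)))
              (before (fromℕ< i<v)))
    ... | tri≈ _ refl _ = inj₂ wv
    ... | tri> _ _ v<i with i ≟F w
    ...   | yes i≡w = inj₁ i≡w
    ...   | no i≢w  = inj₂ (subst T (adj-sym M i w) (stable i v v<i li lv w (i≢w ∘ sym) vw))

  -- A non-isolated vertex is high, or equal to `w`, or one of the at most `m` neighbours of `w`. If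
  -- no low vertex is non-isolated, the high ones alone suffice.
  ∣V∣≤ : ∀ {t m} → (∀ i → degree a i ≤ m) → Stable t M →
    ∣ V M ∣ ≤ (m + 1) + (∑[ i < n ] χ (high t i))
  ∣V∣≤ {t} {m} deg≤m stable = begin
    ∣ V M ∣                                   ≡⟨ ∣∣≡∑χ (V M) ⟩
    (∑[ i < n ] χ (lookup (V M) i))           ≤⟨ bound (low-vertices-covered stable) ⟩
    (m + 1) + (∑[ i < n ] χ (high t i))       ∎
    where
    open ≤-Reasoning
    bound : (∀ i → ¬ LowVertex t i) ⊎ (∃ λ w → ∀ i → LowVertex t i → i ≡ w ⊎ T (a w i)) →
      (∑[ i < n ] χ (lookup (V M) i)) ≤ (m + 1) + (∑[ i < n ] χ (high t i))
    bound (inj₁ none) = ≤-trans (∑-mono-≤ V≤high) (m≤n+m _ _)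
      where
      V≤high : ∀ i → χ (lookup (V M) i) ≤ χ (high t i)
      V≤high i rewrite lookup-V i with t ≤? degree a i
      ... | yes t≤ rewrite dec-true (t ≤? degree a i) t≤ = χ≤1 (does (neighbour? i))
        where
        χ≤1 : ∀ b → χ b ≤ 1
        χ≤1 true  = ≤-refl
        χ≤1 false = z≤n
      ... | no t≰ with neighbour? i
      ...   | yes nb = contradiction (≰⇒> t≰ , nb) (none i)
      ...   | no _   = z≤n
    bound (inj₂ (w , covered)) = begin
      (∑[ i < n ] χ (lookup (V M) i))
        ≤⟨ ∑-mono-≤ V≤ ⟩
      (∑[ i < n ] (χ (a w i) + χ (does (i ≟F w)) + χ (high t i)))
        ≡⟨ trans (∑-distrib-+ (λ i → χ (a w i) + χ (does (i ≟F w))) _)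
             (cong (_+ sum (χ ∘ high t)) (∑-distrib-+ (χ ∘ a w) _)) ⟩
      degree a w + (∑[ i < n ] χ (does (i ≟F w))) + (∑[ i < n ] χ (high t i))
        ≤⟨ +-monoˡ-≤ _ (+-mono-≤ (deg≤m w) (≤-reflexive at-w)) ⟩
      (m + 1) + (∑[ i < n ] χ (high t i)) ∎
      where
      at-w : (∑[ i < n ] χ (does (i ≟F w))) ≡ 1
      at-w = trans (∑-single w λ i i≢w → cong χ (dec-false (i ≟F w) i≢w)) (cong χ (dec-true (w ≟F w) refl))
      V≤ : ∀ i → χ (lookup (V M) i) ≤ χ (a w i) + χ (does (i ≟F w)) + χ (high t i)
      V≤ i rewrite lookup-V i with neighbour? i
      ... | no _   = z≤n
      ... | yes nb with t ≤? degree a i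
      ...   | yes t≤ rewrite dec-true (t ≤? degree a i) t≤ = m≤n+m 1 _
      ...   | no t≰ with covered i (≰⇒> t≰ , nb)
      ...     | inj₁ i≡w rewrite dec-true (i ≟F w) i≡w = ≤-trans (m≤n+m 1 (χ (a w i))) (m≤m+n (χ (a w i) + 1) _)
      ...     | inj₂ wi rewrite T⇒≡true wi = s≤s z≤n

-- The bound over the rationals and the conclusion

/1≤/ : ∀ h s t .{{_ : NonZero t}} → h * t ≤ s → (+ h / 1) ≤ℚ (+ s / t)
/1≤/ h s (suc t-1) ht≤s = ℚ.toℚᵘ-cancel-≤
  (ℚᵘ.≤-respˡ-≃ (ℚᵘ.≃-sym (ℚ.toℚᵘ-fromℚᵘ (ℚᵘ.mkℚᵘ (+ h) 0)))
  (ℚᵘ.≤-respʳ-≃ (ℚᵘ.≃-sym (ℚ.toℚᵘ-fromℚᵘ (ℚᵘ.mkℚᵘ (+ s) t-1)))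
  (ℚᵘ.*≤* (subst₂ ℤ._≤_ (ℤ.pos-* h (suc t-1)) (sym (ℤ.*-identityʳ (+ s))) (ℤ.+≤+ ht≤s)))))

≤+⇒/1≤/1+/ : ∀ v m h s t .{{_ : NonZero t}} → v ≤ m + h → h * t ≤ s →
  (+ v / 1) ≤ℚ (+ m / 1) +ℚ (+ s / t)
≤+⇒/1≤/1+/ v m h s t v≤m+h ht≤s = begin
  + v / 1                  ≤⟨ /1-mono-≤ {v} {m + h} v≤m+h ⟩
  + (m + h) / 1            ≡⟨ /1-homo-+ m h ⟩
  (+ m / 1) +ℚ (+ h / 1)   ≤⟨ ℚ.+-monoʳ-≤ (+ m / 1) {+ h / 1} {+ s / t} (/1≤/ h s t ht≤s) ⟩
  (+ m / 1) +ℚ (+ s / t)   ∎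
  where open ℚ.≤-Reasoning

stable-mask-bound : ∀ {n} k D t .{{_ : NonZero t}} (M : Mask n) (S : Stabilisation k D t M) →
  (+ ∣ V (Stabilisation.mask S) ∣ / 1) ≤ℚ (+ (2 * t + 2) / 1) +ℚ (+ (2 * size M) / t)
stable-mask-bound {n} k D t M (stabilisation N _ size≡ degree≤2t stable) =
  ≤+⇒/1≤/1+/ ∣ V N ∣ (2 * t + 2) #high (2 * size M) t
    -- The closed neighbourhood of `w` contributes `2 * t + 1`, relaxed here to `2 * t + 2`.
    (≤-trans (∣V∣≤ N degree≤2t stable) (+-monoˡ-≤ #high (+-monoʳ-≤ (2 * t) (n≤1+n 1))))
    (subst (λ s → #high * t ≤ 2 * s) size≡ (high*t≤2size N t))
  where
  #high = ∑[ i < n ] χ (high N t i)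

lemma3p6 : (n k D t : ℕ) .{{_ : NonZero t}} → k ≤ n →
    (M : Mask n) → (∀ (v : Fin n) → v ∈ V M → deg M v ≤ 2 * t) →
    Σ (Mask n) λ M′ →
    (LDUB k D n M ≤ℚ LDUB k D n M′) ×
    (+ ∣ V M′ ∣ / 1 ≤ℚ (+ (2 * t + 2) / 1) +ℚ (+ (2 * size M) / t))
lemma3p6 n k D t _ M deg≤2t = mask S , LDUB≤ S , stable-mask-bound k D t M S
  where
  open Stabilisation
  S = stabilise k D t M (deg≤⇒degree≤ M deg≤2t) (<-wellFounded _)
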